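{- For every even integer $k \geq 4$, every integer $t \geq 3$ and every positive integer $s \equiv 0 \pmod{2t}$, the graph $C_k \times K_s$ has a $C_{kt}$-factorization.
   Context: $C_m$ denotes the cycle on $m$ vertices and $K_n$ the complete graph on $n$ vertices. For graphs $G,H$, the tensor product $G \times H$ has vertex set $V(G)\times V(H)$, with $(g_1,h_1)$ adjacent to $(g_2,h_2)$ iff $g_1g_2 \in E(G)$ and $h_1h_2 \in E(H)$. A $C_m$-factor of a graph is a spanning subgraph all of whose components are cycles of length $m$; a $C_m$-factorization is a partition of the edge set into $C_m$-factors. -}

module Defs where

open import Data.Nat using (ℕ; zero; suc; _%_)
open import Data.Nat.DivMod using (m%n<n)
open import Data.Fin using (Fin; toℕ; fromℕ<)
open import Data.Product using (Σ; _×_; _,_)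
open import Data.Sum using (_⊎_)
open import Relation.Binary.PropositionalEquality using (_≡_; _≢_)
open import Function.Definitions using (Injective)

-- A (simple) graph on a vertex type V is given by its adjacency relation.
Rel : Set → Set₁
Rel V = V → V → Set

next : ∀ {m} → Fin m → Fin m
next {suc n} i = fromℕ< (m%n<n (suc (toℕ i)) (suc n))

Cycle : (m : ℕ) → Rel (Fin m)
Cycle m i j = (next i ≡ j) ⊎ (next j ≡ i)

Complete : (n : ℕ) → Rel (Fin n)
Complete n i j = i ≢ j

Tensor : ∀ {A B : Set} → Rel A → Rel B → Rel (A × B)
Tensor G H (g₁ , h₁) (g₂ , h₂) = G g₁ g₂ × H h₁ h₂

EdgeAt : ∀ {V : Set} {m : ℕ} → (Fin m → V) → Fin m → V → V → Set
EdgeAt c i u v = (c i ≡ u × c (next i) ≡ v) ⊎ (c i ≡ v × c (next i) ≡ u)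

record CmFactor {V : Set} (G : Rel V) (m : ℕ) : Set where
  field
    numCycles : ℕ
    cyc       : Fin numCycles → Fin m → V
    cycInj    : ∀ j → Injective _≡_ _≡_ (cyc j)
    cycEdges  : ∀ j i → G (cyc j i) (cyc j (next i))
    cover     : ∀ v → Σ (Fin numCycles × Fin m) λ { (j , i) →
                  (cyc j i ≡ v) ×
                  (∀ j' i' → cyc j' i' ≡ v → (j ≡ j') × (i ≡ i')) }

record CmFactorization {V : Set} (G : Rel V) (m : ℕ) : Set where
  field
    numFactors : ℕ
    factor     : Fin numFactors → CmFactor G m
    partition  : ∀ u v → G u v →
      Σ (Fin numFactors) λ f →
      Σ (Fin (CmFactor.numCycles (factor f))) λ j →
      Σ (Fin m) λ i →
        EdgeAt (CmFactor.cyc (factor f) j) i u v ×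
        (∀ f' j' i' → EdgeAt (CmFactor.cyc (factor f') j') i' u v →
           f ≡ f')

{-# OPTIONS --safe #-}

-- Let P and Q be two Latin squares on the s symbols, both with an identity row o.  For every other
-- row f, follow P f, its inverse, P f, its inverse, … around C_k, but replace the last inverse by Q f.
-- These walks partition the edges of C_k × K_s, and they form cycles of length kt as soon as all
-- orbits of Q f ∘ P f have length t.
--
-- On the symbols ℤ/r × ℤ/2 × ℤ/t, s = 2tr, take for P f the translation by f = (w , b , y) and for
-- Q f the translation by (− w , b , 1 − y): the product is the translation by (0 , 0 , 1).  Since
-- row 0 has to be the identity in both squares, Q must send row A = (0 , 0 , 1) to itself, so
-- that the product in row A is the translation by (0 , 0 , 2), whose orbits are too short for even t.
-- This is repaired by interchanging the rows A and (0 , 1 , 1) of P over y ∈ {t − 2 , t − 1}: the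
-- twist in ℤ/2 doubles the orbits of row A and does not lengthen those of the other row.
module Submission where

open import Defs
open import Algebra.Bundles using (AbelianGroup)
import Algebra.Properties.AbelianGroup as AbelianGroupProperties
open import Data.Bool using (Bool; true; false; not; _∧_; _∨_; _xor_; if_then_else_)
open import Data.Bool.Properties using (not-¬; not-involutive; xor-assoc; xor-comm; xor-same; xor-identityʳ; ∧-zeroʳ; ∧-identityʳ; ∨-zeroʳ; ∧-distribʳ-xor)
open import Data.Empty using (⊥; ⊥-elim)
open import Data.Fin using (Fin; toℕ; combine; remQuot; cast; punchIn; punchOut)
open import Data.Fin.Patterns using (0F; 1F)
open import Data.Fin.Properties using (_≟_; toℕ-fromℕ<; toℕ-injective; toℕ<n; toℕ≤n; toℕ-combine; remQuot-combine; combine-remQuot; combine-surjective; punchInᵢ≢i; punchIn-injective; punchIn-punchOut; cast-is-id; cast-involutive; 2↔Bool; *↔×)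
open import Data.Nat using (ℕ; zero; suc; _+_; _∸_; _≤_; _<_; _*_; _%_; z≤n; s≤s; NonZero; >-nonZero)
open import Data.Nat.Divisibility using (_∣_; divides)
open import Data.Nat.DivMod using (_mod_; %-distribˡ-+; %-distribˡ-*; n%n≡0; [m+n]%n≡m%n; [m+kn]%n≡m%n; m<n⇒m%n≡m; m%n<n; m%n%n≡m%n)
import Data.Nat.Properties as ℕ
open import Data.Product using (Σ; ∃; _×_; _,_; proj₁; proj₂)
open import Data.Product.Function.NonDependent.Propositional using (_×-↔_)
open import Data.Product.Properties using (,-injective)
open import Data.Sum using (_⊎_; inj₁; inj₂; swap)
open import Function using (_∘_)
open import Function.Bundles using (_↔_; Inverse; mk↔ₛ′)
open import Function.Construct.Composition using (_↔-∘_)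
open import Function.Construct.Identity using (↔-id)
open import Function.Construct.Symmetry using (↔-sym)
open import Relation.Nullary using (yes; no; does; contradiction)
open import Relation.Nullary.Decidable using (dec-true; dec-false)
open import Relation.Binary.PropositionalEquality

-- Arithmetic modulo n

toℕ-mod : ∀ m n .{{_ : NonZero n}} → toℕ (m mod n) ≡ m % n
toℕ-mod m n = toℕ-fromℕ< (m%n<n m n)

mod-cong-% : ∀ a b n .{{_ : NonZero n}} → a % n ≡ b % n → a mod n ≡ b mod n
mod-cong-% a b n eq = toℕ-injective (trans (toℕ-mod a n) (trans eq (sym (toℕ-mod b n))))

toℕ-mod-inverse : ∀ {n} .{{_ : NonZero n}} (i : Fin n) → toℕ i mod n ≡ i
toℕ-mod-inverse {n} i = toℕ-injective (trans (toℕ-mod (toℕ i) n) (m<n⇒m%n≡m (toℕ<n i)))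

mod-absorb-+ : ∀ a b n .{{_ : NonZero n}} → (toℕ (a mod n) + b) mod n ≡ (a + b) mod n
mod-absorb-+ a b n = mod-cong-% _ _ n (begin
  (toℕ (a mod n) + b) % n         ≡⟨ cong (λ z → (z + b) % n) (toℕ-mod a n) ⟩
  (a % n + b) % n                 ≡⟨ %-distribˡ-+ (a % n) b n ⟩
  (a % n % n + b % n) % n         ≡⟨ cong (λ z → (z + b % n) % n) (m%n%n≡m%n a n) ⟩
  (a % n + b % n) % n             ≡⟨ %-distribˡ-+ a b n ⟨
  (a + b) % n                     ∎)
  where open ≡-Reasoning

mod-absorb-* : ∀ a b n .{{_ : NonZero n}} → (a * toℕ (b mod n)) mod n ≡ (a * b) mod n
mod-absorb-* a b n = mod-cong-% _ _ n (begin
  (a * toℕ (b mod n)) % n         ≡⟨ cong (λ z → (a * z) % n) (toℕ-mod b n) ⟩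
  (a * (b % n)) % n               ≡⟨ %-distribˡ-* a (b % n) n ⟩
  ((a % n) * (b % n % n)) % n     ≡⟨ cong (λ z → ((a % n) * z) % n) (m%n%n≡m%n b n) ⟩
  ((a % n) * (b % n)) % n         ≡⟨ %-distribˡ-* a b n ⟨
  (a * b) % n                     ∎)
  where open ≡-Reasoning

-- Bundled as a group so that the cancellation laws needed for translations come from the general
-- theory.
ℤ/ : ∀ n .{{_ : NonZero n}} → AbelianGroup _ _
ℤ/ n = record
  { Carrier = Fin n
  ; _≈_ = _≡_
  ; _∙_ = _⊕_
  ; ε   = 0 mod n
  ; _⁻¹ = ⊖_
  ; isAbelianGroup = record
    { isGroup = record
      { isMonoid = record
        { isSemigroup = record
          { isMagma = record { isEquivalence = isEquivalence ; ∙-cong = cong₂ _⊕_ }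
          ; assoc = assoc }
        ; identity = identityˡ , λ i → trans (comm i (0 mod n)) (identityˡ i) }
      ; inverse = inverseˡ , λ i → trans (comm i (⊖ i)) (inverseˡ i)
      ; ⁻¹-cong = cong ⊖_ }
    ; comm = comm } }
  where
  open ≡-Reasoning
  _⊕_ : Fin n → Fin n → Fin n
  i ⊕ j = (toℕ i + toℕ j) mod n
  ⊖_ : Fin n → Fin n
  ⊖ i = (n ∸ toℕ i) mod n
  comm : ∀ i j → i ⊕ j ≡ j ⊕ i
  comm i j = cong (_mod n) (ℕ.+-comm (toℕ i) (toℕ j))
  assoc : ∀ i j k → (i ⊕ j) ⊕ k ≡ i ⊕ (j ⊕ k)
  assoc i j k = begin
    (i ⊕ j) ⊕ k                           ≡⟨ mod-absorb-+ (toℕ i + toℕ j) (toℕ k) n ⟩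
    (toℕ i + toℕ j + toℕ k) mod n         ≡⟨ cong (_mod n) (trans (ℕ.+-assoc (toℕ i) _ _) (ℕ.+-comm (toℕ i) _)) ⟩
    (toℕ j + toℕ k + toℕ i) mod n         ≡⟨ mod-absorb-+ (toℕ j + toℕ k) (toℕ i) n ⟨
    (j ⊕ k) ⊕ i                           ≡⟨ comm (j ⊕ k) i ⟩
    i ⊕ (j ⊕ k)                           ∎
  identityˡ : ∀ i → (0 mod n) ⊕ i ≡ i
  identityˡ i = trans (mod-absorb-+ 0 (toℕ i) n) (toℕ-mod-inverse i)
  inverseˡ : ∀ i → (⊖ i) ⊕ i ≡ 0 mod n
  inverseˡ i = begin
    (⊖ i) ⊕ i                     ≡⟨ mod-absorb-+ (n ∸ toℕ i) (toℕ i) n ⟩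
    (n ∸ toℕ i + toℕ i) mod n     ≡⟨ cong (_mod n) (ℕ.m∸n+n≡m (toℕ≤n i)) ⟩
    n mod n                       ≡⟨ mod-cong-% n 0 n ([m+n]%n≡m%n 0 n) ⟩
    0 mod n                       ∎

-- The cyclic successor and its carry rule

next-⊕ : ∀ n .{{_ : NonZero n}} (i : Fin n) → next i ≡ AbelianGroup._∙_ (ℤ/ n) i (1 mod n)
next-⊕ n@(suc _) i = sym (begin
  (toℕ i + toℕ (1 mod n)) mod n  ≡⟨ cong (_mod n) (ℕ.+-comm (toℕ i) _) ⟩
  (toℕ (1 mod n) + toℕ i) mod n  ≡⟨ mod-absorb-+ 1 (toℕ i) n ⟩
  next i                         ∎)
  where open ≡-Reasoning

toℕ-next-< : ∀ {n} (i : Fin n) → suc (toℕ i) < n → toℕ (next i) ≡ suc (toℕ i)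
toℕ-next-< {n@(suc _)} i lt = trans (toℕ-mod (suc (toℕ i)) n) (m<n⇒m%n≡m lt)

toℕ-next-≡ : ∀ {n} (i : Fin n) → suc (toℕ i) ≡ n → toℕ (next i) ≡ 0
toℕ-next-≡ {n@(suc _)} i eq = trans (toℕ-mod (suc (toℕ i)) n) (trans (cong (_% n) eq) (n%n≡0 n))

last? : ∀ {n} (i : Fin n) → suc (toℕ i) < n ⊎ suc (toℕ i) ≡ n
last? i = ℕ.m≤n⇒m<n∨m≡n (toℕ<n i)

module _ {m k} (q : Fin m) (p : Fin k) where
  open ℕ.≤-Reasoning

  -- `combine q p` is the number k q + p, so `p` is its low digit in base k; here no carry occurs.
  next-combine-< : suc (toℕ p) < k → next (combine q p) ≡ combine q (next p)
  next-combine-< lt = toℕ-injective (begin-equality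
    toℕ (next (combine q p))     ≡⟨ toℕ-next-< (combine q p) bound ⟩
    suc (toℕ (combine q p))      ≡⟨ eq ⟩
    toℕ (combine q (next p))     ∎)
    where
    eq : suc (toℕ (combine q p)) ≡ toℕ (combine q (next p))
    eq = begin-equality
      suc (toℕ (combine q p))      ≡⟨ cong suc (toℕ-combine q p) ⟩
      suc (k * toℕ q + toℕ p)      ≡⟨ ℕ.+-suc _ _ ⟨
      k * toℕ q + suc (toℕ p)      ≡⟨ cong (k * toℕ q +_) (toℕ-next-< p lt) ⟨
      k * toℕ q + toℕ (next p)     ≡⟨ toℕ-combine q (next p) ⟨
      toℕ (combine q (next p))     ∎
    bound : suc (toℕ (combine q p)) < m * k
    bound = subst (_< m * k) (sym eq) (toℕ<n (combine q (next p)))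

  -- The carry case. It includes the wrap from the last number to 0, because `next q` wraps as well.
  next-combine-≡ : suc (toℕ p) ≡ k → next (combine q p) ≡ combine (next q) (next p)
  next-combine-≡ p-last = toℕ-injective (trans (aux (last? q)) (sym rhs))
    where
    lhs : suc (toℕ (combine q p)) ≡ suc (toℕ q) * k
    lhs = begin-equality
      suc (toℕ (combine q p))      ≡⟨ cong suc (toℕ-combine q p) ⟩
      suc (k * toℕ q + toℕ p)      ≡⟨ ℕ.+-suc _ _ ⟨
      k * toℕ q + suc (toℕ p)      ≡⟨ cong (k * toℕ q +_) p-last ⟩
      k * toℕ q + k                ≡⟨ ℕ.+-comm _ k ⟩
      k + k * toℕ q                ≡⟨ cong (k +_) (ℕ.*-comm k (toℕ q)) ⟩
      suc (toℕ q) * k              ∎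
    rhs : toℕ (combine (next q) (next p)) ≡ toℕ (next q) * k
    rhs = begin-equality
      toℕ (combine (next q) (next p))    ≡⟨ toℕ-combine (next q) (next p) ⟩
      k * toℕ (next q) + toℕ (next p)    ≡⟨ cong₂ _+_ (ℕ.*-comm k _) (toℕ-next-≡ p p-last) ⟩
      toℕ (next q) * k + 0               ≡⟨ ℕ.+-identityʳ _ ⟩
      toℕ (next q) * k                   ∎
    aux : suc (toℕ q) < m ⊎ suc (toℕ q) ≡ m → toℕ (next (combine q p)) ≡ toℕ (next q) * k
    aux (inj₁ lt) = begin-equality
      toℕ (next (combine q p))   ≡⟨ toℕ-next-< (combine q p) bound ⟩
      suc (toℕ (combine q p))    ≡⟨ lhs ⟩
      suc (toℕ q) * k            ≡⟨ cong (_* k) (toℕ-next-< q lt) ⟨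
      toℕ (next q) * k           ∎
      where
      bound : suc (toℕ (combine q p)) < m * k
      bound = begin-strict
        suc (toℕ (combine q p))    ≡⟨ lhs ⟩
        suc (toℕ q) * k            <⟨ ℕ.m<n+m (suc (toℕ q) * k) (subst (0 <_) p-last (s≤s z≤n)) ⟩
        suc (suc (toℕ q)) * k      ≤⟨ ℕ.*-monoˡ-≤ k lt ⟩
        m * k                      ∎
    aux (inj₂ eq) = begin-equality
      toℕ (next (combine q p))   ≡⟨ toℕ-next-≡ (combine q p) (trans lhs (cong (_* k) eq)) ⟩
      0                          ≡⟨ cong (_* k) (toℕ-next-≡ q eq) ⟨
      toℕ (next q) * k           ∎

-- Cycles going around C_k

parity : ℕ → Bool
parity zero    = false
parity (suc n) = not (parity n)

-- For k ≥ 3 an edge of C_k has only one forward orientation; this keeps a walk that always moves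
-- forward from covering an edge in reverse.
next-next≢ : ∀ {k} → 3 ≤ k → (i : Fin k) → next (next i) ≢ i
next-next≢ {k} 3≤k i eq = aux (last? i)
  where
  aux : suc (toℕ i) < k ⊎ suc (toℕ i) ≡ k → ⊥
  aux (inj₂ i-last) = ℕ.<-irrefl (cong suc (sym i≡1)) (subst (2 <_) (sym i-last) 3≤k)
    where
    next≡0 : toℕ (next i) ≡ 0
    next≡0 = toℕ-next-≡ i i-last
    i≡1 : toℕ i ≡ 1
    i≡1 = trans (cong toℕ (sym eq))
      (trans (toℕ-next-< (next i) (subst (λ z → suc z < k) (sym next≡0) (ℕ.<⇒≤ 3≤k))) (cong suc next≡0))
  aux (inj₁ i<) with last? (next i)
  ... | inj₁ lt = ℕ.m≢1+n+m (toℕ i) {1} (trans (cong toℕ (sym eq)) (trans (toℕ-next-< (next i) lt) (cong suc (toℕ-next-< i i<))))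
  ... | inj₂ e = ℕ.<-irrefl (trans (cong (λ z → suc (suc z)) (sym i≡0)) (trans (cong suc (sym (toℕ-next-< i i<))) e)) 3≤k
    where
    i≡0 : toℕ i ≡ 0
    i≡0 = trans (cong toℕ (sym eq)) (toℕ-next-≡ (next i) e)

↔-injective : ∀ {A B : Set} (φ : A ↔ B) {x y} → Inverse.to φ x ≡ Inverse.to φ y → x ≡ y
↔-injective φ eq = trans (sym (strictlyInverseʳ _)) (trans (cong from eq) (strictlyInverseʳ _))
  where open Inverse φ

-- What remains of a Latin square with an identity row when that row is deleted: every off-diagonal
-- pair is realised by exactly one row.
SharplyTransitive : ∀ {N s} → (Fin N → Fin s → Fin s) → Set
SharplyTransitive P = (∀ f x → x ≢ P f x) ×
  (∀ x x' → x ≢ x' → ∃ λ f → P f x ≡ x' × (∀ f' → P f' x ≡ x' → f ≡ f'))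

module Wrapping {k nJ t s N : ℕ} (3≤k : 3 ≤ k) (k-even : parity k ≡ false)
  (P : Fin N → Fin s ↔ Fin s) (Q : Fin N → Fin s → Fin s)
  (P-sharp : SharplyTransitive (Inverse.to ∘ P)) (Q-sharp : SharplyTransitive Q)
  -- `θ f (j , q)` is the q-th point of the j-th orbit of Q f ∘ P f. Bijectivity together with the
  -- wrap of `next` makes every orbit have length t.
  (θ : Fin N → (Fin nJ × Fin t) ↔ Fin s)
  (QPθ≡θ-next : ∀ f j q → Q f (Inverse.to (P f) (Inverse.to (θ f) (j , q))) ≡ Inverse.to (θ f) (j , next q))
  where

  open Inverse using (to; from; strictlyInverseˡ; strictlyInverseʳ)

  -- Alternating `P f` with its inverse, a walk that starts a turn at x stands at x over every even
  -- position of C_k and at `P f` x over every odd one.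
  layer : Fin N → Bool → Fin s ↔ Fin s
  layer f false = ↔-id _
  layer f true  = P f

  at : Fin N → Fin nJ → Fin t → Fin k → Fin s
  at f j q p = to (layer f (parity (toℕ p))) (to (θ f) (j , q))

  -- Index k q + p is position `p` of the q-th turn around C_k; t turns exhaust the orbit.
  cycle : Fin N → Fin nJ → Fin (t * k) → Fin k × Fin s
  cycle f j i = let q , p = remQuot k i in p , at f j q p

  cycle-combine : ∀ f j q p → cycle f j (combine q p) ≡ (p , at f j q p)
  cycle-combine f j q p = cong (λ { (q , p) → p , at f j q p }) (remQuot-combine q p)

  -- One constructor for each kind of move. `down` states the inverse of `P f` as an equation for
  -- `P f`, and `close` replaces the last `down` of each turn.
  data Step (f : Fin N) (p : Fin k) (x x' : Fin s) : Set where
    up    : parity (toℕ p) ≡ false → to (P f) x ≡ x' → Step f p x x'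
    down  : parity (toℕ p) ≡ true → suc (toℕ p) < k → to (P f) x' ≡ x → Step f p x x'
    close : suc (toℕ p) ≡ k → Q f x ≡ x' → Step f p x x'

  last-odd : ∀ {p} → suc p ≡ k → parity p ≡ true
  last-odd {p} eq with parity p | trans (cong parity eq) k-even
  ... | true | _ = refl

  at-step : ∀ f j q p → ∃ λ x' → cycle f j (next (combine q p)) ≡ (next p , x') × Step f p (at f j q p) x'
  at-step f j q p with last? p
  ... | inj₁ lt = at f j q (next p) ,
    trans (cong (cycle f j) (next-combine-< q p lt)) (cycle-combine f j q (next p)) , step
    where
    step : Step f p (at f j q p) (at f j q (next p))
    step rewrite toℕ-next-< p lt with parity (toℕ p) in eq
    ... | false = up eq refl
    ... | true  = down eq lt refl
  ... | inj₂ p-last = at f j (next q) (next p) ,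
    trans (cong (cycle f j) (next-combine-≡ q p p-last)) (cycle-combine f j (next q) (next p)) , step
    where
    step : Step f p (at f j q p) (at f j (next q) (next p))
    -- The last position is odd, hence in layer `P f`, and position 0 is in the identity layer: the
    -- closing move is the orbit equation for Q f ∘ P f.
    step rewrite toℕ-next-≡ p p-last | last-odd p-last = close p-last (QPθ≡θ-next f j q)

  cycle-step : ∀ {f j i p x} → cycle f j i ≡ (p , x) →
    ∃ λ x' → cycle f j (next i) ≡ (next p , x') × Step f p x x'
  cycle-step {f} {j} {i} eq with combine-surjective {t} {k} i
  ... | q , p , refl with refl ← trans (sym (cycle-combine f j q p)) eq = at-step f j q p

  step-from-edge : ∀ {f j i p p' x x'} → cycle f j i ≡ (p , x) → cycle f j (next i) ≡ (p' , x') →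
    next p ≡ p' × Step f p x x'
  step-from-edge eq eq' with cycle-step eq
  ... | _ , eq'' , step with refl ← trans (sym eq'') eq' = refl , step

  step-functional : ∀ {f p x x₁ x₂} → Step f p x x₁ → Step f p x x₂ → x₁ ≡ x₂
  step-functional (up _ a) (up _ b) = trans (sym a) b
  step-functional (up e _) (down e' _ _) = ⊥-elim (not-¬ e e')
  step-functional (up e _) (close l _) = ⊥-elim (not-¬ e (last-odd l))
  step-functional (down e _ _) (up e' _) = ⊥-elim (not-¬ e' e)
  step-functional {f} (down _ _ a) (down _ _ b) = ↔-injective (P f) (trans a (sym b))
  step-functional (down _ lt _) (close l _) = ⊥-elim (ℕ.<-irrefl l lt)
  step-functional (close l _) (up e _) = ⊥-elim (not-¬ e (last-odd l))
  step-functional (close l _) (down _ lt _) = ⊥-elim (ℕ.<-irrefl l lt)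
  step-functional (close _ a) (close _ b) = trans (sym a) b

  step-irrefl : ∀ {f p x x'} → Step f p x x' → x ≢ x'
  step-irrefl (up _ e)     refl = proj₁ P-sharp _ _ (sym e)
  step-irrefl (down _ _ e) refl = proj₁ P-sharp _ _ (sym e)
  step-irrefl (close _ e)  refl = proj₁ Q-sharp _ _ (sym e)

  -- The position `p` alone decides which constructor of `Step` can occur, so existence and
  -- uniqueness of `f` are inherited from one Latin square; for `down` the two symbols change roles.
  step-sharp : ∀ p x x' → x ≢ x' → ∃ λ f → Step f p x x' × (∀ f' → Step f' p x x' → f ≡ f')
  step-sharp p x x' x≢x' with parity (toℕ p) in eq | last? p
  ... | false | _ =
    let f , e , unique = proj₂ P-sharp x x' x≢x' in f , up eq e , λ where
      f' (up _ e') → unique f' e'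
      f' (down eq' _ _) → ⊥-elim (not-¬ eq eq')
      f' (close l _) → ⊥-elim (not-¬ eq (last-odd l))
  ... | true | inj₁ lt =
    let f , e , unique = proj₂ P-sharp x' x (≢-sym x≢x') in f , down eq lt e , λ where
      f' (up eq' _) → ⊥-elim (not-¬ eq' eq)
      f' (down _ _ e') → unique f' e'
      f' (close l _) → ⊥-elim (ℕ.<-irrefl l lt)
  ... | true | inj₂ l =
    let f , e , unique = proj₂ Q-sharp x x' x≢x' in f , close l e , λ where
      f' (up eq' _) → ⊥-elim (not-¬ eq' eq)
      f' (down _ lt _) → ⊥-elim (ℕ.<-irrefl l lt)
      f' (close _ e') → unique f' e'

  -- The vertex shows `p`; undoing the layer and then `θ f` recovers `j` and `q`. This gives both
  -- injectivity and disjointness of the cycles.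
  cycle-injective : ∀ f j j' i i' → cycle f j i ≡ cycle f j' i' → j ≡ j' × i ≡ i'
  cycle-injective f j j' i i' eq with combine-surjective {t} {k} i | combine-surjective {t} {k} i'
  ... | q , p , refl | q' , p' , refl
    with refl , at≡ ← ,-injective (trans (sym (cycle-combine f j q p)) (trans eq (cycle-combine f j' q' p')))
    with refl ← ↔-injective (θ f) (↔-injective (layer f (parity (toℕ p))) at≡) = refl , refl

  cycle-surjective : ∀ f v → ∃ λ j → ∃ λ i → cycle f j i ≡ v
  cycle-surjective f (p , x) = j , combine q p , (begin
    cycle f j (combine q p)              ≡⟨ cycle-combine f j q p ⟩
    p , to ℓ (to (θ f) (j , q))          ≡⟨ cong (λ y → p , to ℓ y) (strictlyInverseˡ (θ f) _) ⟩
    p , to ℓ (from ℓ x)                  ≡⟨ cong (p ,_) (strictlyInverseˡ ℓ x) ⟩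
    p , x                                ∎)
    where
    open ≡-Reasoning
    ℓ = layer f (parity (toℕ p))
    j = proj₁ (from (θ f) (from ℓ x))
    q = proj₂ (from (θ f) (from ℓ x))

  Graph : Rel (Fin k × Fin s)
  Graph = Tensor (Cycle k) (Complete s)

  factor : Fin N → CmFactor Graph (t * k)
  factor f = record
    { numCycles = nJ
    ; cyc = cycle f
    ; cycInj = λ j eq → proj₂ (cycle-injective f j j _ _ eq)
    ; cycEdges = edges
    ; cover = λ v → let j , i , eq = cycle-surjective f v in
        (j , i) , eq , λ j' i' eq' → cycle-injective f j j' i i' (trans eq (sym eq'))
    }
    where
    edges : ∀ j i → Graph (cycle f j i) (cycle f j (next i))
    edges j i = let eq , step = step-from-edge {f} {j} {i} refl refl in inj₁ eq , step-irrefl step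

  directed-edge : ∀ p x x' → x ≢ x' → ∃ λ f → ∃ λ j → ∃ λ i →
    (cycle f j i ≡ (p , x) × cycle f j (next i) ≡ (next p , x')) ×
    (∀ f' j' i' → EdgeAt (cycle f' j') i' (p , x) (next p , x') → f ≡ f')
  directed-edge p x x' x≢x' with step-sharp p x x' x≢x'
  ... | f , step , unique with cycle-surjective f (p , x)
  ... | j , i , eq with cycle-step eq
  -- The cycle of `f` through (p , x) leaves it by some step of `f`, and a step is determined by its
  -- start, so it arrives at `x'`.
  ... | _ , eq' , step' with refl ← step-functional step' step =
    f , j , i , (eq , eq') , λ where
      f' j' i' (inj₁ (a , b)) → unique f' (proj₂ (step-from-edge a b))
      -- A backward traversal would be a forward move from `next p` to `p`.
      f' j' i' (inj₂ (a , b)) → ⊥-elim (next-next≢ 3≤k p (proj₁ (step-from-edge a b)))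

  factorization : CmFactorization Graph (t * k)
  factorization = record { numFactors = N ; factor = factor ; partition = part }
    where
    part : ∀ u v → Graph u v → Σ (Fin N) λ f → Σ (Fin nJ) λ j → Σ (Fin (t * k)) λ i →
      EdgeAt (cycle f j) i u v × (∀ f' j' i' → EdgeAt (cycle f' j') i' u v → f ≡ f')
    part (p , x) (_ , x') (inj₁ refl , x≢x') =
      let f , j , i , e , unique = directed-edge p x x' x≢x' in
      f , j , i , inj₁ e , unique
    part (_ , x) (p , x') (inj₂ refl , x≢x') =
      let f , j , i , e , unique = directed-edge p x' x (≢-sym x≢x') in
      f , j , i , inj₂ e , λ f' j' i' → unique f' j' i' ∘ swap

-- Latin squares with an identity row

xor-cancelˡ : ∀ a b → a xor (a xor b) ≡ b
xor-cancelˡ a b = trans (sym (xor-assoc a a b)) (cong (_xor b) (xor-same a))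

xor-cancelʳ : ∀ a b → (a xor b) xor b ≡ a
xor-cancelʳ a b = trans (xor-assoc a b b) (trans (cong (a xor_) (xor-same b)) (xor-identityʳ a))

module NonIdentityRows {X : Set} {N : ℕ} (φ : X ↔ Fin (suc N)) (o : X) where
  open Inverse φ

  -- `punchIn` skips the index of `o`, so the s - 1 indices enumerate exactly the other rows, one
  -- for each factor.
  row : Fin N → X
  row i = from (punchIn (to o) i)

  row≢o : ∀ i → row i ≢ o
  row≢o i eq = punchInᵢ≢i (to o) i (trans (sym (strictlyInverseˡ _)) (cong to eq))

  row-injective : ∀ {i i'} → row i ≡ row i' → i ≡ i'
  row-injective eq = punchIn-injective (to o) _ _
    (trans (sym (strictlyInverseˡ _)) (trans (cong to eq) (strictlyInverseˡ _)))

  row-surjective : ∀ {f} → f ≢ o → ∃ λ i → row i ≡ f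
  row-surjective {f} f≢o = punchOut to-o≢to-f , trans (cong from (punchIn-punchOut to-o≢to-f)) (strictlyInverseʳ f)
    where
    to-o≢to-f : to o ≢ to f
    to-o≢to-f eq = f≢o (sym (↔-injective φ eq))

  -- P f is row f of a Latin square on X whose row o is the identity.
  rows-sharp : (P quot : X → X → X) → (∀ x → P o x ≡ x) →
    (∀ x x' → P (quot x x') x ≡ x') → (∀ f x → quot x (P f x) ≡ f) →
    SharplyTransitive (λ i → to ∘ P (row i) ∘ from)
  rows-sharp P quot P-o P-quot quot-P = fixed-point-free , transitive
    where
    open ≡-Reasoning
    fixed-point-free : ∀ i x → x ≢ to (P (row i) (from x))
    fixed-point-free i x eq = row≢o i (begin
      row i                                ≡⟨ quot-P (row i) (from x) ⟨
      quot (from x) (P (row i) (from x))   ≡⟨ cong (quot (from x)) (trans (cong from eq) (strictlyInverseʳ _)) ⟨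
      quot (from x) (from x)               ≡⟨ cong (quot (from x)) (P-o (from x)) ⟨
      quot (from x) (P o (from x))         ≡⟨ quot-P o (from x) ⟩
      o                                    ∎)
    transitive : ∀ x x' → x ≢ x' → ∃ λ i → to (P (row i) (from x)) ≡ x' ×
      (∀ i' → to (P (row i') (from x)) ≡ x' → i ≡ i')
    transitive x x' x≢x' with row-surjective {quot (from x) (from x')} quot≢o
      where
      quot≢o : quot (from x) (from x') ≢ o
      quot≢o eq = x≢x' (begin
        x                                             ≡⟨ strictlyInverseˡ x ⟨
        to (from x)                                   ≡⟨ cong to (P-o (from x)) ⟨
        to (P o (from x))                             ≡⟨ cong (λ f → to (P f (from x))) eq ⟨
        to (P (quot (from x) (from x')) (from x))     ≡⟨ cong to (P-quot _ _) ⟩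
        to (from x')                                  ≡⟨ strictlyInverseˡ x' ⟩
        x'                                            ∎)
    ... | i , row-i = i ,
      trans (cong (λ f → to (P f (from x))) row-i) (trans (cong to (P-quot _ _)) (strictlyInverseˡ x')) ,
      λ i' eq → row-injective (begin
        row i                                  ≡⟨ row-i ⟩
        quot (from x) (from x')                ≡⟨ cong (quot (from x) ∘ from) eq ⟨
        quot (from x) (from (to (P (row i') (from x))))  ≡⟨ cong (quot (from x)) (strictlyInverseʳ _) ⟩
        quot (from x) (P (row i') (from x))    ≡⟨ quot-P _ _ ⟩
        row i'                                 ∎)

  -- Transports the walks from `X` to Fin s along `φ`. A quotient map returns the row that takes one
  -- symbol to another, which turns the Latin property into equations; `J` labels the orbits.
  rows-factorization : ∀ {k t nJ} {J : Set} → 3 ≤ k → parity k ≡ false →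
    (P : X → X ↔ X) (Q P-quot Q-quot : X → X → X) →
    (∀ x → Inverse.to (P o) x ≡ x) →
    (∀ x x' → Inverse.to (P (P-quot x x')) x ≡ x') → (∀ f x → P-quot x (Inverse.to (P f) x) ≡ f) →
    (∀ x → Q o x ≡ x) →
    (∀ x x' → Q (Q-quot x x') x ≡ x') → (∀ f x → Q-quot x (Q f x) ≡ f) →
    Fin nJ ↔ J →
    (∀ f → f ≢ o → Σ ((J × Fin t) ↔ X) λ θ → ∀ j q →
      Q f (Inverse.to (P f) (Inverse.to θ (j , q))) ≡ Inverse.to θ (j , next q)) →
    CmFactorization (Tensor (Cycle k) (Complete (suc N))) (t * k)
  rows-factorization {t = t} 3≤k k-even P Q P-quot Q-quot P-o P-quot-correct P-quot-unique
    Q-o Q-quot-correct Q-quot-unique ψ orbits =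
    Wrapping.factorization 3≤k k-even
      (λ i → φ ↔-∘ (P (row i) ↔-∘ ↔-sym φ))
      (λ i → to ∘ Q (row i) ∘ from)
      (rows-sharp (Inverse.to ∘ P) P-quot P-o P-quot-correct P-quot-unique)
      (rows-sharp Q Q-quot Q-o Q-quot-correct Q-quot-unique)
      (λ i → φ ↔-∘ (θ i ↔-∘ (ψ ×-↔ ↔-id (Fin t))))
      (λ i j q → let x = Inverse.to (θ i) (Inverse.to ψ j , q) in cong to (begin
        Q (row i) (from (to (Inverse.to (P (row i)) (from (to x)))))  ≡⟨ cong (Q (row i)) (strictlyInverseʳ _) ⟩
        Q (row i) (Inverse.to (P (row i)) (from (to x)))              ≡⟨ cong (Q (row i) ∘ Inverse.to (P (row i))) (strictlyInverseʳ x) ⟩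
        Q (row i) (Inverse.to (P (row i)) x)                          ≡⟨ proj₂ (orbits (row i) (row≢o i)) (Inverse.to ψ j) q ⟩
        Inverse.to (θ i) (Inverse.to ψ j , next q)                    ∎))
    where
    open ≡-Reasoning
    θ : ∀ i → _ ↔ X
    θ i = proj₁ (orbits (row i) (row≢o i))

-- The two Latin squares

-- All orbits of (b , y) ↦ (b xor switch y , y + 2), switch y = l (y + 1) xor l y, have length t:
-- each one is the image of some {c} × Fin t.
record TwistedDoubling {t : ℕ} (l : Fin t → Bool) : Set where
  field
    orbits : (Bool × Fin t) ↔ (Bool × Fin t)
    step   : ∀ c q → let b , y = Inverse.to orbits (c , q) in
      Inverse.to orbits (c , next q) ≡ (b xor (l (next y) xor l y) , next (next y))

module Rows (r t : ℕ) .{{_ : NonZero r}} .{{_ : NonZero t}} (l : Fin t → Bool)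
  (1≢0 : 1 mod t ≢ 0 mod t) (doubling : TwistedDoubling l) where

  private
    module W = AbelianGroup (ℤ/ r)
    module Wₚ = AbelianGroupProperties (ℤ/ r)
    module T = AbelianGroup (ℤ/ t)
    module Tₚ = AbelianGroupProperties (ℤ/ t)
    open W using () renaming (_∙_ to _+ʷ_; ε to 0ʷ; _⁻¹ to ⊖ʷ_)
    open T using () renaming (_∙_ to _+ᵗ_; ε to 0ᵗ; _⁻¹ to ⊖ᵗ_; _-_ to _-ᵗ_)
    open ≡-Reasoning
    1ᵗ : Fin t
    1ᵗ = 1 mod t

  X : Set
  X = (Fin r × Bool) × Fin t

  o : X
  o = (0ʷ , false) , 0ᵗ

  -- Being the coboundary of `l`, the twists telescope along an orbit in which y advances by 1 and
  -- cancel over a full turn, so such an orbit still closes after t steps.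
  switch : Fin t → Bool
  switch y = l (next y) xor l y

  switched : Fin r → Fin t → Bool
  switched w y = does (w ≟ 0ʷ) ∧ does (y ≟ 1ᵗ)

  -- Translation by f, except that rows (0 , false , 1) and (0 , true , 1) trade places at the points with switch y.
  P : X → X → X
  P ((fw , fb) , fy) ((w , b) , y) = (w +ʷ fw , b xor (fb xor (switch y ∧ switched fw fy))) , y +ᵗ fy

  P⁻¹ : X → X → X
  P⁻¹ ((fw , fb) , fy) ((w , b) , y) =
    (w W.- fw , b xor (fb xor (switch (y -ᵗ fy) ∧ switched fw fy))) , y -ᵗ fy

  P-↔ : X → X ↔ X
  P-↔ f@((fw , fb) , fy) = mk↔ₛ′ (P f) (P⁻¹ f)
    (λ { ((w , b) , y) → cong₂ _,_ (cong₂ _,_ (Wₚ.//-rightDividesˡ fw w) (xor-cancelʳ b _)) (Tₚ.//-rightDividesˡ fy y) })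
    (λ { ((w , b) , y) → cong₂ _,_ (cong₂ _,_ (Wₚ.//-rightDividesʳ fw w)
        (trans (cong (λ z → (b xor (fb xor (switch y ∧ switched fw fy))) xor (fb xor (switch z ∧ switched fw fy)))
                  (Tₚ.//-rightDividesʳ fy y))
               (xor-cancelʳ b _)))
      (Tₚ.//-rightDividesʳ fy y) })

  -- The condition for switching involves only the w and y parts of the row. These are read off
  -- first, and then the bit can be corrected.
  P-quot : X → X → X
  P-quot ((w , b) , y) ((w' , b') , y') = (fw , (b xor b') xor (switch y ∧ switched fw fy)) , fy
    where
    fw = (⊖ʷ w) +ʷ w'
    fy = (⊖ᵗ y) +ᵗ y'

  P-o : ∀ x → P o x ≡ x
  P-o ((w , b) , y) = cong₂ _,_ (cong₂ _,_ (W.identityʳ w) (begin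
    b xor (switch y ∧ (does (0ʷ ≟ 0ʷ) ∧ does (0ᵗ ≟ 1ᵗ)))  ≡⟨ cong (λ z → b xor (switch y ∧ (does (0ʷ ≟ 0ʷ) ∧ z))) (dec-false (0ᵗ ≟ 1ᵗ) (≢-sym 1≢0)) ⟩
    b xor (switch y ∧ (does (0ʷ ≟ 0ʷ) ∧ false))           ≡⟨ cong (λ z → b xor (switch y ∧ z)) (∧-zeroʳ (does (0ʷ ≟ 0ʷ))) ⟩
    b xor (switch y ∧ false)                              ≡⟨ cong (b xor_) (∧-zeroʳ (switch y)) ⟩
    b xor false                                           ≡⟨ xor-identityʳ b ⟩
    b                                                     ∎)) (T.identityʳ y)

  P-quot-correct : ∀ x x' → P (P-quot x x') x ≡ x'
  P-quot-correct ((w , b) , y) ((w' , b') , y') = cong₂ _,_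
    (cong₂ _,_ (Wₚ.\\-leftDividesˡ w w') (trans (cong (b xor_) (xor-cancelʳ (b xor b') _)) (xor-cancelˡ b b')))
    (Tₚ.\\-leftDividesˡ y y')

  P-quot-unique : ∀ f x → P-quot x (P f x) ≡ f
  P-quot-unique ((fw , fb) , fy) ((w , b) , y) = cong₂ _,_
    (cong₂ _,_ eqw (begin
      (b xor (b xor (fb xor (switch y ∧ switched fw fy)))) xor (switch y ∧ switched ((⊖ʷ w) +ʷ (w +ʷ fw)) ((⊖ᵗ y) +ᵗ (y +ᵗ fy)))
        ≡⟨ cong₂ _xor_ (xor-cancelˡ b _) (cong₂ (λ u v → switch y ∧ switched u v) eqw eqy) ⟩
      (fb xor (switch y ∧ switched fw fy)) xor (switch y ∧ switched fw fy)
        ≡⟨ xor-cancelʳ fb _ ⟩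
      fb ∎)) eqy
    where
    eqw = Wₚ.\\-leftDividesʳ w fw
    eqy = Tₚ.\\-leftDividesʳ y fy

  0∨1 : Fin t → Bool
  0∨1 y = does (y ≟ 0ᵗ) ∨ does (y ≟ 1ᵗ)

  -- The rows (0 , false , 0) and (0 , false , 1) must not be interchanged, since Q o has to be the identity.
  reflect : Bool → Fin t → Fin t
  reflect special y = if special ∧ 0∨1 y then y else 1ᵗ -ᵗ y

  1-[1-y] : ∀ y → 1ᵗ -ᵗ (1ᵗ -ᵗ y) ≡ y
  1-[1-y] y = begin
    1ᵗ +ᵗ (⊖ᵗ (1ᵗ -ᵗ y))   ≡⟨ cong (1ᵗ +ᵗ_) (Tₚ.⁻¹-anti-homo-// 1ᵗ y) ⟩
    1ᵗ +ᵗ (y -ᵗ 1ᵗ)        ≡⟨ T.assoc 1ᵗ y _ ⟨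
    (1ᵗ +ᵗ y) -ᵗ 1ᵗ        ≡⟨ Tₚ.xyx⁻¹≈y 1ᵗ y ⟩
    y                      ∎

  y+[1-y] : ∀ y → y +ᵗ (1ᵗ -ᵗ y) ≡ 1ᵗ
  y+[1-y] y = trans (sym (T.assoc y 1ᵗ _)) (Tₚ.xyx⁻¹≈y y 1ᵗ)

  -- y ↦ 1 - y interchanges 0 and 1, so the exceptional set is stable and fixing it pointwise keeps
  -- `reflect` an involution.
  0∨1-reflect : ∀ y → 0∨1 (1ᵗ -ᵗ y) ≡ 0∨1 y
  0∨1-reflect y with y ≟ 0ᵗ | y ≟ 1ᵗ
  ... | yes refl | _ = trans (cong (does ((1ᵗ -ᵗ y) ≟ 0ᵗ) ∨_) (dec-true ((1ᵗ -ᵗ y) ≟ 1ᵗ) 1-0)) (∨-zeroʳ _)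
    where
    1-0 : 1ᵗ -ᵗ 0ᵗ ≡ 1ᵗ
    1-0 = trans (cong (1ᵗ +ᵗ_) Tₚ.ε⁻¹≈ε) (T.identityʳ 1ᵗ)
  ... | no _ | yes refl = cong (_∨ does ((1ᵗ -ᵗ y) ≟ 1ᵗ)) (dec-true ((1ᵗ -ᵗ y) ≟ 0ᵗ) (T.inverseʳ 1ᵗ))
  ... | no y≢0 | no y≢1 = cong₂ _∨_ (dec-false ((1ᵗ -ᵗ y) ≟ 0ᵗ) λ eq → y≢1 (sym (Tₚ.x∙y⁻¹≈ε⇒x≈y _ _ eq)))
      (dec-false ((1ᵗ -ᵗ y) ≟ 1ᵗ) λ eq → y≢0 (trans (sym (1-[1-y] y)) (trans (cong (1ᵗ -ᵗ_) eq) (T.inverseʳ 1ᵗ))))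

  reflect-involutive : ∀ special y → reflect special (reflect special y) ≡ y
  reflect-involutive special y with special ∧ 0∨1 y in eq
  ... | true  rewrite eq = refl
  ... | false rewrite 0∨1-reflect y | eq = 1-[1-y] y

  special : Fin r → Bool → Bool
  special w b = does (w ≟ 0ʷ) ∧ not b

  Q : X → X → X
  Q ((fw , fb) , fy) ((w , b) , y) = (w W.- fw , b xor fb) , y +ᵗ reflect (special fw fb) fy

  Q-quot : X → X → X
  Q-quot ((w , b) , y) ((w' , b') , y') = (fw , fb) , reflect (special fw fb) ((⊖ᵗ y) +ᵗ y')
    where
    fw = ⊖ʷ ((⊖ʷ w) +ʷ w')
    fb = b xor b'

  Q-o : ∀ x → Q o x ≡ x
  Q-o ((w , b) , y) = cong₂ _,_
    (cong₂ _,_ (trans (cong (w +ʷ_) Wₚ.ε⁻¹≈ε) (W.identityʳ w)) (xor-identityʳ b))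
    (trans (cong (y +ᵗ_) reflect-0) (T.identityʳ y))
    where
    reflect-0 : reflect (special 0ʷ false) 0ᵗ ≡ 0ᵗ
    reflect-0 rewrite dec-true (0ʷ ≟ 0ʷ) refl | dec-true (0ᵗ ≟ 0ᵗ) refl = refl

  Q-quot-correct : ∀ x x' → Q (Q-quot x x') x ≡ x'
  Q-quot-correct ((w , b) , y) ((w' , b') , y') = cong₂ _,_
    (cong₂ _,_ (trans (cong (w +ʷ_) (Wₚ.⁻¹-involutive _)) (Wₚ.\\-leftDividesˡ w w')) (xor-cancelˡ b b'))
    (trans (cong (y +ᵗ_) (reflect-involutive (special (⊖ʷ ((⊖ʷ w) +ʷ w')) (b xor b')) _)) (Tₚ.\\-leftDividesˡ y y'))

  Q-quot-unique : ∀ f x → Q-quot x (Q f x) ≡ f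
  Q-quot-unique ((fw , fb) , fy) ((w , b) , y) = cong₂ _,_ (cong₂ _,_ eqw eqb)
    (trans (cong₂ reflect (cong₂ special eqw eqb) (Tₚ.\\-leftDividesʳ y _)) (reflect-involutive (special fw fb) fy))
    where
    eqw = trans (cong ⊖ʷ_ (Wₚ.\\-leftDividesʳ w _)) (Wₚ.⁻¹-involutive fw)
    eqb = xor-cancelˡ b fb

  -- The w parts cancel, and so do the two copies of `fb` in ℤ/2. Only the twist and the total shift
  -- of y survive.
  QP : ∀ fw fb fy w b y → Q ((fw , fb) , fy) (P ((fw , fb) , fy) ((w , b) , y)) ≡
    ((w , b xor (switch y ∧ switched fw fy)) , y +ᵗ (fy +ᵗ reflect (special fw fb) fy))
  QP fw fb fy w b y = cong₂ _,_ (cong₂ _,_ (Wₚ.//-rightDividesʳ fw w) (begin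
      (b xor (fb xor e)) xor fb   ≡⟨ xor-assoc b (fb xor e) fb ⟩
      b xor ((fb xor e) xor fb)   ≡⟨ cong (b xor_) (xor-comm (fb xor e) fb) ⟩
      b xor (fb xor (fb xor e))   ≡⟨ cong (b xor_) (xor-cancelˡ fb e) ⟩
      b xor e                     ∎)) (T.assoc y fy _)
    where e = switch y ∧ switched fw fy

  A : X
  A = (0ʷ , false) , 1ᵗ

  -- y + (1 - y) = 1 wherever `reflect` reflects. It fails to do so only for `o`, which is excluded,
  -- and for `A`.
  total-shift : ∀ fw fb fy → ((fw , fb) , fy) ≢ o →
    fy +ᵗ reflect (special fw fb) fy ≡ 1ᵗ ⊎ ((fw , fb) , fy) ≡ A
  total-shift fw fb fy f≢o with fw ≟ 0ʷ | fb | fy ≟ 0ᵗ | fy ≟ 1ᵗ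
  ... | yes refl | false | yes refl | _        = contradiction refl f≢o
  ... | yes refl | false | no _     | yes refl = inj₂ refl
  ... | yes refl | false | no _     | no _     = inj₁ (y+[1-y] fy)
  ... | yes refl | true  | _        | _        = inj₁ (y+[1-y] fy)
  ... | no _     | _     | _        | _        = inj₁ (y+[1-y] fy)

  -- `X` already is a product with Fin t, so a labelling of the orbits is a permutation of `X`.
  orbits : ∀ f → f ≢ o → Σ (X ↔ X) λ θ → ∀ j q →
    Q f (P f (Inverse.to θ (j , q))) ≡ Inverse.to θ (j , next q)
  orbits f@((fw , fb) , fy) f≢o with total-shift fw fb fy f≢o
  -- Total shift 1: if the row is switched, offsetting the bit at height q by `l q` straightens the
  -- orbits. The offset is its own inverse.
  ... | inj₁ eq = mk↔ₛ′ θ θ θθ θθ , λ { (w , b) q → trans (QP fw fb fy w (b xor (l q ∧ e)) q)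
      (cong₂ _,_ (cong (w ,_) (begin
        (b xor (l q ∧ e)) xor ((l (next q) xor l q) ∧ e)      ≡⟨ xor-assoc b _ _ ⟩
        b xor ((l q ∧ e) xor ((l (next q) xor l q) ∧ e))      ≡⟨ cong (b xor_) (∧-distribʳ-xor e (l q) _) ⟨
        b xor ((l q xor (l (next q) xor l q)) ∧ e)            ≡⟨ cong (λ z → b xor (z ∧ e)) (trans (xor-comm (l q) _) (xor-cancelʳ (l (next q)) (l q))) ⟩
        b xor (l (next q) ∧ e)                                ∎))
        (trans (cong (q +ᵗ_) eq) (sym (next-⊕ t q)))) }
    where
    e = switched fw fy
    θ : X → X
    θ ((w , b) , q) = (w , b xor (l q ∧ e)) , q
    θθ : ∀ x → θ (θ x) ≡ x
    θθ ((w , b) , q) = cong (λ z → (w , z) , q) (xor-cancelʳ b _)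
  -- Row `A`: for each fixed w the product is the twisted doubling.
  ... | inj₂ refl = mk↔ₛ′ θ θ⁻¹
      (λ { ((w , b) , y) → cong (λ { (b , y) → (w , b) , y }) (strictlyInverseˡ (b , y)) })
      (λ { ((w , b) , y) → cong (λ { (b , y) → (w , b) , y }) (strictlyInverseʳ (b , y)) }) ,
      λ { (w , c) q → let b , y = to (c , q) in trans (QP 0ʷ false 1ᵗ w b y)
        (trans (σ-A w b y) (cong (λ { (b , y) → (w , b) , y }) (sym (TwistedDoubling.step doubling c q)))) }
    where
    open Inverse (TwistedDoubling.orbits doubling)
    θ θ⁻¹ : X → X
    θ ((w , c) , q) = let b , y = to (c , q) in (w , b) , y
    θ⁻¹ ((w , b) , y) = let c , q = from (b , y) in (w , c) , q
    shift-A : reflect (special 0ʷ false) 1ᵗ ≡ 1ᵗ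
    shift-A rewrite dec-true (0ʷ ≟ 0ʷ) refl | dec-true (1ᵗ ≟ 1ᵗ) refl | dec-false (1ᵗ ≟ 0ᵗ) 1≢0 = refl
    σ-A : ∀ w b y → ((w , b xor (switch y ∧ switched 0ʷ 1ᵗ)) , y +ᵗ (1ᵗ +ᵗ reflect (special 0ʷ false) 1ᵗ))
      ≡ ((w , b xor switch y) , next (next y))
    σ-A w b y = cong₂ (λ u v → (w , b xor u) , v)
      (trans (cong (switch y ∧_) switched-A) (∧-identityʳ (switch y)))
      (begin
        y +ᵗ (1ᵗ +ᵗ reflect (special 0ʷ false) 1ᵗ)   ≡⟨ cong (λ z → y +ᵗ (1ᵗ +ᵗ z)) shift-A ⟩
        y +ᵗ (1ᵗ +ᵗ 1ᵗ)     ≡⟨ T.assoc y 1ᵗ 1ᵗ ⟨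
        (y +ᵗ 1ᵗ) +ᵗ 1ᵗ     ≡⟨ next-⊕ t (y +ᵗ 1ᵗ) ⟨
        next (y +ᵗ 1ᵗ)      ≡⟨ cong next (next-⊕ t y) ⟨
        next (next y)       ∎)
      where
      switched-A : switched 0ʷ 1ᵗ ≡ true
      switched-A = cong₂ _∧_ (dec-true (0ʷ ≟ 0ʷ) refl) (dec-true (1ᵗ ≟ 1ᵗ) refl)

next-mod : ∀ a n .{{_ : NonZero n}} → next (a mod n) ≡ suc a mod n
next-mod a n@(suc _) = begin
  (1 + toℕ (a mod n)) mod n    ≡⟨ cong (_mod n) (ℕ.+-comm 1 _) ⟩
  (toℕ (a mod n) + 1) mod n    ≡⟨ mod-absorb-+ a 1 n ⟩
  (a + 1) mod n                ≡⟨ cong (_mod n) (ℕ.+-comm a 1) ⟩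
  suc a mod n                  ∎
  where open ≡-Reasoning

-- Orbits of the exceptional row

odd-doubling : ∀ h → TwistedDoubling {suc (h * 2)} (λ _ → false)
odd-doubling h = record
  { orbits = ↔-id Bool ×-↔ mk↔ₛ′ (scale 2) (scale (suc h)) (scale-inverse 2 (suc h) (ℕ.*-comm 2 (suc h))) (scale-inverse (suc h) 2 refl)
  ; step = λ c q → cong₂ _,_ (sym (xor-identityʳ c)) (begin
      scale 2 (next q)              ≡⟨ mod-absorb-* 2 (suc (toℕ q)) t ⟩
      (2 * suc (toℕ q)) mod t       ≡⟨ cong (_mod t) (ℕ.*-suc 2 (toℕ q)) ⟩
      (2 + 2 * toℕ q) mod t         ≡⟨ next-mod (1 + 2 * toℕ q) t ⟨
      next ((1 + 2 * toℕ q) mod t)  ≡⟨ cong next (next-mod (2 * toℕ q) t) ⟨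
      next (next (scale 2 q))       ∎)
  }
  where
  open ≡-Reasoning
  t = suc (h * 2)
  scale : ℕ → Fin t → Fin t
  scale a i = (a * toℕ i) mod t
  scale-inverse : ∀ a b → a * b ≡ suc h * 2 → ∀ i → scale a (scale b i) ≡ i
  scale-inverse a b ab≡1 i = begin
    scale a (scale b i)            ≡⟨ mod-absorb-* a (b * toℕ i) t ⟩
    (a * (b * toℕ i)) mod t        ≡⟨ cong (_mod t) (ℕ.*-assoc a b (toℕ i)) ⟨
    (a * b * toℕ i) mod t          ≡⟨ cong (λ z → (z * toℕ i) mod t) ab≡1 ⟩
    (toℕ i + t * toℕ i) mod t      ≡⟨ cong (λ z → (toℕ i + z) mod t) (ℕ.*-comm t (toℕ i)) ⟩
    (toℕ i + toℕ i * t) mod t      ≡⟨ mod-cong-% (toℕ i + toℕ i * t) (toℕ i) t ([m+kn]%n≡m%n (toℕ i) (toℕ i) t) ⟩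
    toℕ i mod t                    ≡⟨ toℕ-mod-inverse i ⟩
    i                              ∎

next-next-combine : ∀ {h} (q : Fin h) (c : Fin 2) → next (next (combine q c)) ≡ combine (next q) c
next-next-combine q 0F = trans (cong next (next-combine-< q 0F (s≤s (s≤s z≤n)))) (next-combine-≡ q 1F refl)
next-next-combine q 1F = trans (cong next (next-combine-≡ q 1F refl)) (next-combine-< (next q) 0F (s≤s (s≤s z≤n)))

next-cast : ∀ {m n} (eq : m ≡ n) (i : Fin m) → next (cast eq i) ≡ cast eq (next i)
next-cast refl i = trans (cong next (cast-is-id refl i)) (sym (cast-is-id refl (next i)))

cast-↔ : ∀ {m n} → m ≡ n → Fin m ↔ Fin n
cast-↔ eq = mk↔ₛ′ (cast eq) (cast (sym eq)) (cast-involutive eq (sym eq)) (cast-involutive (sym eq) eq)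

module _ {h : ℕ} where
  open Inverse 2↔Bool using () renaming (to to bit)

  isLast : Fin h → Bool
  isLast q = does (suc (toℕ q) ℕ.≟ h)

  -- The indicator of y = t - 1; its coboundary is supported on t - 2 and t - 1.
  top : Fin (h * 2) → Bool
  top y = let q , c = remQuot 2 y in bit c ∧ isLast q

  top-combine : ∀ q c → top (combine q c) ≡ bit c ∧ isLast q
  top-combine q c = cong (λ { (q , c) → bit c ∧ isLast q }) (remQuot-combine q c)

  -- The value does not depend on `c`: each parity class of y meets one twist in its h steps, which
  -- joins its two orbits of length h into one of length t.
  top-switch : ∀ q c → top (next (combine q c)) xor top (combine q c) ≡ isLast q
  top-switch q 0F = trans (cong₂ _xor_
    (trans (cong top (next-combine-< q 0F (s≤s (s≤s z≤n)))) (top-combine q 1F)) (top-combine q 0F)) (xor-identityʳ _)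
  top-switch q 1F = cong₂ _xor_
    (trans (cong top (next-combine-≡ q 1F refl)) (top-combine (next q) 0F)) (top-combine q 1F)

  -- Writing y = 2 q + c, the twisted doubling fixes c and is the successor map on the number b h + q of ℤ/2h.
  even-doubling : TwistedDoubling top
  even-doubling = record { orbits = mk↔ₛ′ (encode ∘ split) (unsplit ∘ decode) inverseˡ inverseʳ ; step = step }
    where
    open ≡-Reasoning
    open Inverse 2↔Bool using () renaming (from to unbit; strictlyInverseˡ to bit-unbit; strictlyInverseʳ to unbit-bit)
    Digits : Set
    Digits = Bool × (Fin 2 × Fin h)
    -- The number b h + q lives in Fin (2 * h), while t is `h * 2`.
    2h : h * 2 ≡ 2 * h
    2h = ℕ.*-comm h 2
    split : Bool × Fin (h * 2) → Digits
    split (c , i) = c , remQuot h (cast 2h i)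
    unsplit : Digits → Bool × Fin (h * 2)
    unsplit (c , b , q) = c , cast (sym 2h) (combine b q)
    encode : Digits → Bool × Fin (h * 2)
    encode (c , b , q) = bit b , combine q (unbit c)
    decode : Bool × Fin (h * 2) → Digits
    decode (b , y) = let q , c = remQuot 2 y in bit c , unbit b , q
    split-unsplit : ∀ d → split (unsplit d) ≡ d
    split-unsplit (c , b , q) = cong (c ,_)
      (trans (cong (remQuot h) (cast-involutive 2h (sym 2h) (combine b q))) (remQuot-combine b q))
    unsplit-split : ∀ x → unsplit (split x) ≡ x
    unsplit-split (c , i) = cong (c ,_)
      (trans (cong (cast (sym 2h)) (combine-remQuot {2} h (cast 2h i))) (cast-involutive (sym 2h) 2h i))
    decode-encode : ∀ d → decode (encode d) ≡ d
    decode-encode (c , b , q) = trans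
      (cong (λ { (q , c) → bit c , unbit (bit b) , q }) (remQuot-combine q (unbit c)))
      (cong₂ (λ c b → c , b , q) (bit-unbit c) (unbit-bit b))
    encode-decode : ∀ x → encode (decode x) ≡ x
    encode-decode (b , y) = cong₂ _,_ (bit-unbit b)
      (trans (cong (combine (proj₁ (remQuot {h} 2 y))) (unbit-bit _)) (combine-remQuot {h} 2 y))
    inverseˡ : ∀ x → encode (split (unsplit (decode x))) ≡ x
    inverseˡ x = trans (cong encode (split-unsplit (decode x))) (encode-decode x)
    inverseʳ : ∀ x → unsplit (decode (encode (split x))) ≡ x
    inverseʳ x = trans (cong unsplit (decode-encode (split x))) (unsplit-split x)

    bit-next : ∀ b → bit (next b) ≡ bit b xor true
    bit-next 0F = refl
    bit-next 1F = refl

    -- The carry out of the digit `q` flips `b` exactly when `q` is last, which is the twist.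
    successor : ∀ c b q → encode (c , remQuot h (next (combine b q))) ≡ (bit b xor isLast q , combine (next q) (unbit c))
    successor c b q with last? q
    ... | inj₁ lt = trans
      (cong (λ d → encode (c , d)) (trans (cong (remQuot h) (next-combine-< b q lt)) (remQuot-combine b (next q))))
      (cong (_, _) (sym (trans (cong (bit b xor_) (dec-false (suc (toℕ q) ℕ.≟ h) (ℕ.<⇒≢ lt))) (xor-identityʳ (bit b)))))
    ... | inj₂ eq = trans
      (cong (λ d → encode (c , d)) (trans (cong (remQuot h) (next-combine-≡ b q eq)) (remQuot-combine (next b) (next q))))
      (cong (_, _) (trans (bit-next b) (cong (bit b xor_) (sym (dec-true (suc (toℕ q) ℕ.≟ h) eq)))))

    step : ∀ c i → let b , y = encode (split (c , i)) in
      encode (split (c , next i)) ≡ (b xor (top (next y) xor top y) , next (next y))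
    step c i with combine-surjective {2} {h} (cast 2h i)
    ... | b , q , eq = begin
      encode (c , remQuot h (cast 2h (next i)))   ≡⟨ cong (λ z → encode (c , remQuot h z)) (trans (sym (next-cast 2h i)) (cong next (sym eq))) ⟩
      encode (c , remQuot h (next (combine b q))) ≡⟨ successor c b q ⟩
      (bit b xor isLast q , combine (next q) (unbit c)) ≡⟨ cong₂ (λ u v → bit b xor u , v) (top-switch q (unbit c)) (next-next-combine q (unbit c)) ⟨
      twist (encode (c , b , q))  ≡⟨ cong (λ z → twist (encode (c , z))) (trans (cong (remQuot h) (sym eq)) (remQuot-combine b q)) ⟨
      twist (encode (split (c , i))) ∎
      where
      twist : Bool × Fin (h * 2) → Bool × Fin (h * 2)
      twist (b , y) = b xor (top (next y) xor top y) , next (next y)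

-- Choice of the twist by the parity of t, and assembly of the factorization

halve : ∀ n → ∃ λ h → n ≡ h * 2 ⊎ n ≡ suc (h * 2)
halve zero = 0 , inj₁ refl
halve (suc n) with halve n
... | h , inj₁ refl = h , inj₂ refl
... | h , inj₂ refl = suc h , inj₁ refl

twistedDoubling : ∀ t → ∃ λ (l : Fin t → Bool) → TwistedDoubling l
twistedDoubling t with halve t
... | h , inj₁ refl = top {h} , even-doubling {h}
... | h , inj₂ refl = _ , odd-doubling h

parity-*2 : ∀ h → parity (h * 2) ≡ false
parity-*2 zero = refl
parity-*2 (suc h) = trans (not-involutive _) (parity-*2 h)

1-mod≢0-mod : ∀ {t} .{{_ : NonZero t}} → 2 ≤ t → 1 mod t ≢ 0 mod t
1-mod≢0-mod {t} 2≤t eq = contradiction (trans (sym (value 2≤t)) (trans (cong toℕ eq) (value (ℕ.<⇒≤ 2≤t)))) λ ()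
  where
  value : ∀ {a} → a < t → toℕ (a mod t) ≡ a
  value {a} a<t = trans (toℕ-mod a t) (m<n⇒m%n≡m a<t)

theorem3p7 : (k t s : ℕ) → 4 ≤ k → 2 ∣ k → 3 ≤ t → 1 ≤ s → (2 * t) ∣ s →
    CmFactorization (Tensor (Cycle k) (Complete s)) (k * t)
-- As s is positive, the quotient r cannot be 0.
theorem3p7 k t s@(suc N) 4≤k (divides h refl) 3≤t _ (divides r@(suc _) s≡r*2t) =
  subst (CmFactorization _) (ℕ.*-comm t k)
    (rows-factorization (ℕ.<⇒≤ 4≤k) (parity-*2 h) P-↔ Q P-quot Q-quot
      P-o P-quot-correct P-quot-unique Q-o Q-quot-correct Q-quot-unique J-↔ orbits)
  where
  instance
    t≢0 : NonZero t
    t≢0 = >-nonZero (ℕ.≤-trans (s≤s z≤n) 3≤t)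
  open Rows r t (proj₁ (twistedDoubling t)) (1-mod≢0-mod (ℕ.<⇒≤ 3≤t)) (proj₂ (twistedDoubling t))
  -- Each factor has 2r cycles, which cover 2r · kt = ks vertices.
  J-↔ : Fin (r * 2) ↔ (Fin r × Bool)
  J-↔ = (↔-id (Fin r) ×-↔ 2↔Bool) ↔-∘ *↔×
  φ : X ↔ Fin s
  φ = cast-↔ (trans (ℕ.*-assoc r 2 t) (sym s≡r*2t)) ↔-∘ (↔-sym *↔× ↔-∘ (↔-sym J-↔ ×-↔ ↔-id (Fin t)))
  open NonIdentityRows φ o
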